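{- Let $\mathcal{F}$ be a union-closed family of finite sets with $\emptyset\in\mathcal{F}$ and with at least two members, and suppose $\mathcal{F}$ is graph generated, i.e. every member of $G(\mathcal{F})$ has exactly one or exactly two elements. Then there is a set $U\in G(\mathcal{F})$ such that $|\mathcal{F}_{\supseteq U}|/|\mathcal{F}|\le 1/2$, where $\mathcal{F}_{\supseteq U}=\{V\in\mathcal{F}: V\supseteq U\}$.
   Context: For a union-closed family $\mathcal{F}$ containing $\emptyset$, $G(\mathcal{F})$ denotes its set of union generators: the nonempty members $V\in\mathcal{F}$ that are not equal to the union of the members of $\mathcal{F}$ properly contained in $V$. Every member of $\mathcal{F}$ is a union of members of $G(\mathcal{F})$, and no member of $G(\mathcal{F})$ is a union of other members of $G(\mathcal{F})$. -}

module Defs where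

open import Data.Nat using (ℕ; _≤_; _*_)
open import Data.Fin.Subset using (Subset; _∪_; ⋃; ⊥; _⊆_; _⊂_; Nonempty; ∣_∣)
open import Data.Fin.Subset.Properties using (_⊆?_; _⊂?_)
open import Data.List using (List; filter; length)
open import Data.List.Membership.Propositional renaming (_∈_ to _∈ˡ_)
open import Data.List.Relation.Unary.Unique.Propositional using (Unique)
open import Data.Product using (_×_)
open import Data.Sum using (_⊎_)
open import Relation.Binary.PropositionalEquality using (_≡_; _≢_)

Family : ℕ → Set
Family n = List (Subset n)

IsFamily : ∀ {n} → Family n → Set
IsFamily F = Unique F

UnionClosed : ∀ {n} → Family n → Set
UnionClosed F = ∀ {A B} → A ∈ˡ F → B ∈ˡ F → (A ∪ B) ∈ˡ F

properSubmembers : ∀ {n} → Family n → Subset n → List (Subset n)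
properSubmembers F V = filter (_⊂? V) F

IsGenerator : ∀ {n} → Family n → Subset n → Set
IsGenerator F V = V ∈ˡ F × Nonempty V × V ≢ ⋃ (properSubmembers F V)

GraphGenerated : ∀ {n} → Family n → Set
GraphGenerated F = ∀ {V} → IsGenerator F V → (∣ V ∣ ≡ 1) ⊎ (∣ V ∣ ≡ 2)

countSupersets : ∀ {n} → Family n → Subset n → ℕ
countSupersets F U = length (filter (U ⊆?_) F)

{-# OPTIONS --safe #-}

-- Join v and y when {v, y} ∈ F, so that v is adjacent to itself when {v} ∈ F; then S ∈ F iff
-- every element of S has a neighbour in S.  Let p(c, d) be the number of S ∈ F with c ∈ S and
-- N(c) ∩ S = {d}, and let (b, x) maximise p over the pairs with {b} ∉ F and x ∈ N(b).
-- Call S ∈ F bad if N(c) ∩ S = {b} for some c ∈ S.  Deleting b maps the remaining S ∋ b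
-- injectively into F, so a neighbour z of b gives the generator {b, z} we want as soon as
--   #bad ≤ 2 · #{S : b ∈ S, z ∉ S} + #{S : S ∩ N[b] = ∅}.
-- By maximality #bad ≤ deg(b) · p(b, x).  Adding some w ∈ N(b) \ {z} to the sets counted by
-- p(b, x), where z ≠ x, shows that #{S : b ∈ S, z ∉ S} ≥ (deg(b) − 1) · p(b, x), which suffices
-- as deg(b) ≥ 2.  If x is the only neighbour of b, then z = x works, because deleting {b, x} maps
-- bad sets to sets that avoid N[b].  If there is no pair (b, x) at all, then every generator is a
-- singleton {v}, and deleting v is an injection.
module Submission where

open import Defs
open import Data.Bool.Properties using () renaming (_≟_ to _≟ᵇ_)
open import Data.Empty using (⊥-elim)
open import Data.Fin using (Fin)
open import Data.Fin.Properties using () renaming (_≟_ to _≟ᶠ_)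
open import Data.Fin.Subset using (Subset; ⊥; ⋃; ⁅_⁆; _∈_; _∉_; _⊆_; _∪_; _∩_; _─_; _-_; ∣_∣; Nonempty; inside; outside)
open import Data.Fin.Subset.Properties
open import Data.List using (List; []; _∷_; filter; length; map; allFin; cartesianProduct)
open import Data.List.Extrema.Nat using (argmax; argmax-all; f[⊥]≤f[argmax]; f[xs]≤f[argmax])
open import Data.List.Membership.Propositional using (find; lose) renaming (_∈_ to _∈ˡ_)
open import Data.List.Membership.Propositional.Properties
  using (∈-filter⁺; ∈-filter⁻; ∈-map⁺; ∈-allFin; ∈-cartesianProduct⁺; ∈-length)
open import Data.List.Properties using (length-map; filter-none; filter-notAll; length-filter)
open import Data.List.Relation.Binary.Subset.Propositional renaming (_⊆_ to _⊆ˡ_)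
open import Data.List.Relation.Unary.All as All using (_∷_)
open import Data.List.Relation.Unary.Any as Any using (Any; here; there)
open import Data.List.Relation.Unary.AllPairs using ([]; _∷_)
open import Data.List.Relation.Unary.Unique.Propositional using (Unique)
import Data.List.Relation.Unary.Unique.Propositional.Properties as Unique
open import Data.Nat using (ℕ; suc; _+_; _*_; _≤_; _<_; z≤n; s≤s)
open import Data.Nat.Induction using (Acc; acc; <-wellFounded)
open import Data.Nat.Properties
open import Data.Product using (Σ; ∃; _×_; _,_; proj₁; proj₂)
open import Data.Sum using (_⊎_; inj₁; inj₂; [_,_]′)
open import Data.Vec using (tabulate; _∷_; here; there)
open import Data.Vec.Properties using (≡-dec; lookup∘tabulate; []=⇒lookup; lookup⇒[]=)
open import Function using (_∘_; id; case_of_)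
open import Relation.Binary.Definitions using (DecidableEquality)
open import Relation.Binary.PropositionalEquality
open import Relation.Nullary using (¬_; yes; no; does; ¬?; _×-dec_; contradiction)
open import Relation.Nullary.Decidable using (dec-true)
open import Relation.Unary using (Decidable)
open import Relation.Unary.Properties using (U?)

private variable
  n : ℕ
  A : Set

-- Counting in lists

-- Deleting the head `x` from `ys` shortens `ys` strictly and loses nothing of the tail, in which
-- `x` does not recur.
length-mono-⊆ : DecidableEquality A → {xs ys : List A} → Unique xs → xs ⊆ˡ ys → length xs ≤ length ys
length-mono-⊆ _≟_ {[]} _ _ = z≤n
length-mono-⊆ _≟_ {x ∷ xs} {ys} (x∉xs ∷ uniq) sub = begin
  suc (length xs)                             ≤⟨ s≤s (length-mono-⊆ _≟_ uniq sub′) ⟩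
  suc (length (filter (λ y → ¬? (x ≟ y)) ys)) ≤⟨ filter-notAll _ ys (Any.map (λ x≡y x≢y → x≢y x≡y) (sub (here refl))) ⟩
  length ys                                   ∎
  where
  open ≤-Reasoning
  sub′ : xs ⊆ˡ filter (λ y → ¬? (x ≟ y)) ys
  sub′ y∈xs = ∈-filter⁺ _ (sub (there y∈xs)) (All.lookup x∉xs y∈xs)

module _ {A : Set} where

  count : {P : A → Set} → Decidable P → List A → ℕ
  count P? xs = length (filter P? xs)

  count-cover : {P Q R : A → Set} (P? : Decidable P) (Q? : Decidable Q) (R? : Decidable R) (xs : List A) →
                (∀ {x} → P x → Q x ⊎ R x) → count P? xs ≤ count Q? xs + count R? xs
  count-cover P? Q? R? [] _ = z≤n
  count-cover P? Q? R? (x ∷ xs) cov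
    with ih ← count-cover P? Q? R? xs cov | P? x | Q? x | R? x
  ... | no _  | no _  | no _  = ih
  ... | no _  | no _  | yes _ = ≤-trans ih (+-monoʳ-≤ _ (n≤1+n _))
  ... | no _  | yes _ | no _  = m≤n⇒m≤1+n ih
  ... | no _  | yes _ | yes _ = m≤n⇒m≤1+n (≤-trans ih (+-monoʳ-≤ _ (n≤1+n _)))
  ... | yes p | no ¬q | no ¬r = ⊥-elim ([ ¬q , ¬r ]′ (cov p))
  ... | yes _ | no _  | yes _ = ≤-trans (s≤s ih) (≤-reflexive (sym (+-suc _ _)))
  ... | yes _ | yes _ | no _  = s≤s ih
  ... | yes _ | yes _ | yes _ = s≤s (≤-trans ih (+-monoʳ-≤ _ (n≤1+n _)))

  count-disjoint : {P Q R : A → Set} (P? : Decidable P) (Q? : Decidable Q) (R? : Decidable R) (xs : List A) →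
                   (∀ {x} → Q x → P x) → (∀ {x} → R x → P x) → (∀ {x} → Q x → ¬ R x) →
                   count Q? xs + count R? xs ≤ count P? xs
  count-disjoint P? Q? R? [] _ _ _ = z≤n
  count-disjoint P? Q? R? (x ∷ xs) q⇒p r⇒p q⇒¬r
    with ih ← count-disjoint P? Q? R? xs q⇒p r⇒p q⇒¬r | P? x | Q? x | R? x
  ... | _     | yes q | yes r = ⊥-elim (q⇒¬r q r)
  ... | no ¬p | yes q | _     = ⊥-elim (¬p (q⇒p q))
  ... | no ¬p | _     | yes r = ⊥-elim (¬p (r⇒p r))
  ... | no _  | no _  | no _  = ih
  ... | yes _ | no _  | no _  = m≤n⇒m≤1+n ih
  ... | yes _ | yes _ | no _  = s≤s ih
  ... | yes _ | no _  | yes _ = ≤-trans (≤-reflexive (+-suc _ _)) (s≤s ih)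

  count-none : {P : A → Set} (P? : Decidable P) (xs : List A) → (∀ x → ¬ P x) → count P? xs ≡ 0
  count-none P? xs ¬p = cong length (filter-none P? (All.universal ¬p xs))

  -- The function `g` undoes the intended map from `P`-elements to `Q`-elements, which replaces a
  -- proof of injectivity: every `P`-element lies in the `g`-image of the list of `Q`-elements.
  count-image : DecidableEquality A → {P Q : A → Set} (P? : Decidable P) (Q? : Decidable Q)
                {xs : List A} → Unique xs → (g : A → A) →
                (∀ {x} → x ∈ˡ xs → P x → ∃ λ y → y ∈ˡ xs × Q y × g y ≡ x) →
                count P? xs ≤ count Q? xs
  count-image _≟_ P? Q? {xs} uniq g preimage = begin
    count P? xs                     ≤⟨ length-mono-⊆ _≟_ (Unique.filter⁺ P? uniq) sub ⟩
    length (map g (filter Q? xs))   ≡⟨ length-map g (filter Q? xs) ⟩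
    count Q? xs                     ∎
    where
    open ≤-Reasoning
    sub : filter P? xs ⊆ˡ map g (filter Q? xs)
    sub x∈ with x∈xs , px ← ∈-filter⁻ P? x∈ with y , y∈xs , qy , refl ← preimage x∈xs px =
      ∈-map⁺ g (∈-filter⁺ Q? y∈xs qy)

  -- The union bound.
  count-Any : {B : Set} {Q : B → A → Set} (Q? : ∀ c → Decidable (Q c)) (k : ℕ) (xs : List A) (cs : List B) →
              (∀ {c} → c ∈ˡ cs → count (Q? c) xs ≤ k) →
              count (λ x → Any.any? (λ c → Q? c x) cs) xs ≤ length cs * k
  count-Any Q? k xs [] _ = ≤-reflexive (count-none _ xs (λ _ ()))
  count-Any Q? k xs (c ∷ cs) bound = ≤-trans
    (count-cover _ (Q? c) (λ x → Any.any? (λ c → Q? c x) cs) xs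
      (λ { (here q) → inj₁ q ; (there q) → inj₂ q }))
    (+-mono-≤ (bound (here refl)) (count-Any Q? k xs cs (bound ∘ there)))

  -- Distinct indices select disjoint sets of entries, so the lower bounds add up.
  count-pack : {B : Set} {Q : B → A → Set} (Q? : ∀ c → Decidable (Q c)) (k : ℕ) (xs : List A) {cs : List B} →
               Unique cs → (∀ {c d x} → Q c x → Q d x → c ≡ d) → (∀ {c} → c ∈ˡ cs → k ≤ count (Q? c) xs) →
               length cs * k ≤ count (λ x → Any.any? (λ c → Q? c x) cs) xs
  count-pack Q? k xs {[]} _ _ _ = z≤n
  count-pack Q? k xs {c ∷ cs} (c∉cs ∷ uniq) excl bound = ≤-trans
    (+-mono-≤ (bound (here refl)) (count-pack Q? k xs uniq excl (bound ∘ there)))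
    (count-disjoint _ (Q? c) (λ x → Any.any? (λ d → Q? d x) cs) xs here there
      (λ q any → All.lookupWith (λ c≢d q′ → c≢d (excl q q′)) c∉cs any))

-- Finite subsets

infix 4 _≟ˢ_
_≟ˢ_ : DecidableEquality (Subset n)
_≟ˢ_ = ≡-dec _≟ᵇ_

x∈p─q⇒x∉q : ∀ {x} (p q : Subset n) → x ∈ p ─ q → x ∉ q
x∈p─q⇒x∉q (_ ∷ p) (outside ∷ q) (there x∈) (there x∈q) = x∈p─q⇒x∉q p q x∈ x∈q
x∈p─q⇒x∉q (_ ∷ p) (inside ∷ q) (there x∈) (there x∈q) = x∈p─q⇒x∉q p q x∈ x∈q

x∈p⇒⁅x⁆⊆p : ∀ {x} {p : Subset n} → x ∈ p → ⁅ x ⁆ ⊆ p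
x∈p⇒⁅x⁆⊆p {p = p} x∈p y∈ = subst (_∈ p) (sym (x∈⁅y⁆⇒x≡y _ y∈)) x∈p

∪-least : {p q r : Subset n} → p ⊆ r → q ⊆ r → p ∪ q ⊆ r
∪-least p⊆r q⊆r = [ p⊆r , q⊆r ]′ ∘ x∈p∪q⁻ _ _

p⊆q⇒q─p∪p≡q : {p q : Subset n} → p ⊆ q → (q ─ p) ∪ p ≡ q
p⊆q⇒q─p∪p≡q {p = p} {q} p⊆q = ⊆-antisym (∪-least (p─q⊆p q p) p⊆q) λ {x} x∈q → x∈p∪q⁺ (split x x∈q)
  where
  split : ∀ x → x ∈ q → x ∈ q ─ p ⊎ x ∈ p
  split x x∈q with x ∈? p
  ... | yes x∈p = inj₂ x∈p
  ... | no x∉p  = inj₁ (x∈p∧x∉q⇒x∈p─q x∈q x∉p)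

x∉p⇒p∪⁅x⁆-x≡p : ∀ {x} {p : Subset n} → x ∉ p → p ∪ ⁅ x ⁆ - x ≡ p
x∉p⇒p∪⁅x⁆-x≡p {x = x} {p} x∉p = ⊆-antisym
  (λ y∈ → [ id , (λ y∈⁅x⁆ → contradiction y∈⁅x⁆ (x∈p─q⇒x∉q (p ∪ ⁅ x ⁆) ⁅ x ⁆ y∈)) ]′ (x∈p∪q⁻ p _ (p─q⊆p _ ⁅ x ⁆ y∈)))
  (λ y∈p → x∈p∧x≢y⇒x∈p-y (p⊆p∪q ⁅ x ⁆ y∈p) λ { refl → x∉p y∈p })

∈⋃⁻ : ∀ {x} (ps : List (Subset n)) → x ∈ ⋃ ps → ∃ λ p → p ∈ˡ ps × x ∈ p
∈⋃⁻ [] x∈ = contradiction x∈ ∉⊥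
∈⋃⁻ (p ∷ ps) x∈ with x∈p∪q⁻ p (⋃ ps) x∈
... | inj₁ x∈p = p , here refl , x∈p
... | inj₂ x∈⋃ with q , q∈ps , x∈q ← ∈⋃⁻ ps x∈⋃ = q , there q∈ps , x∈q

∈⋃⁺ : ∀ {x} {p : Subset n} {ps} → p ∈ˡ ps → x ∈ p → x ∈ ⋃ ps
∈⋃⁺ (here refl) x∈p = x∈p∪q⁺ (inj₁ x∈p)
∈⋃⁺ (there p∈) x∈p = x∈p∪q⁺ (inj₂ (∈⋃⁺ p∈ x∈p))

-- The element `y` may equal `x`: a singleton becomes a degenerate pair, which fits the loops of the
-- graph.
∣p∣≤2⇒pair : ∀ {x} {p : Subset n} → x ∈ p → ∣ p ∣ ≤ 2 → ∃ λ y → y ∈ p × p ≡ ⁅ x ⁆ ∪ ⁅ y ⁆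
∣p∣≤2⇒pair {x = x} {p} x∈p ∣p∣≤2 with nonempty? (p - x)
... | no ¬ne = x , x∈p , ⊆-antisym
  (λ {y} y∈p → x∈p∪q⁺ (inj₁ (only y y∈p)))
  (∪-least (x∈p⇒⁅x⁆⊆p x∈p) (x∈p⇒⁅x⁆⊆p x∈p))
  where
  only : ∀ y → y ∈ p → y ∈ ⁅ x ⁆
  only y y∈p with y ≟ᶠ x
  ... | yes refl = x∈⁅x⁆ x
  ... | no y≢x   = contradiction (y , x∈p∧x≢y⇒x∈p-y y∈p y≢x) ¬ne
... | yes (y , y∈p-x) = y , y∈p , ⊆-antisym
  (λ {z} z∈p → x∈p∪q⁺ (only z z∈p))
  (∪-least (x∈p⇒⁅x⁆⊆p x∈p) (x∈p⇒⁅x⁆⊆p y∈p))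
  where
  y∈p = p─q⊆p p ⁅ x ⁆ y∈p-x
  only : ∀ z → z ∈ p → z ∈ ⁅ x ⁆ ⊎ z ∈ ⁅ y ⁆
  only z z∈p with z ≟ᶠ x | z ≟ᶠ y
  ... | yes refl | _        = inj₁ (x∈⁅x⁆ x)
  ... | no _     | yes refl = inj₂ (x∈⁅x⁆ y)
  ... | no z≢x   | no z≢y   = contradiction ∣p∣≤2 (<⇒≱ (begin-strict
    2                       ≤⟨ s≤s (s≤s z≤n) ⟩
    2 + ∣ p - x - y - z ∣   <⟨ s≤s (s≤s (x∈p⇒∣p-x∣<∣p∣ (x∈p∧x≢y⇒x∈p-y (x∈p∧x≢y⇒x∈p-y z∈p z≢x) z≢y))) ⟩
    2 + ∣ p - x - y ∣       ≤⟨ s≤s (x∈p⇒∣p-x∣<∣p∣ y∈p-x) ⟩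
    1 + ∣ p - x ∣           ≤⟨ x∈p⇒∣p-x∣<∣p∣ x∈p ⟩
    ∣ p ∣                   ∎))
    where open ≤-Reasoning

-- The graph of a graph-generated family

module GraphFamily {n : ℕ} (F : Family n) (unique : IsFamily F) (∪-closed : UnionClosed F)
                   (⊥∈F : ⊥ ∈ˡ F) (graph : GraphGenerated F) where

  open import Data.List.Membership.DecPropositional (_≟ˢ_ {n}) using () renaming (_∈?_ to _∈ˡ?_)

  N : Fin n → Subset n
  N v = tabulate (λ y → does (⁅ v ⁆ ∪ ⁅ y ⁆ ∈ˡ? F))

  ∈N⁺ : ∀ {v y} → ⁅ v ⁆ ∪ ⁅ y ⁆ ∈ˡ F → y ∈ N v
  ∈N⁺ {v} {y} e = lookup⇒[]= y _ (trans (lookup∘tabulate _ y) (dec-true (⁅ v ⁆ ∪ ⁅ y ⁆ ∈ˡ? F) e))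

  ∈N⁻ : ∀ {v y} → y ∈ N v → ⁅ v ⁆ ∪ ⁅ y ⁆ ∈ˡ F
  ∈N⁻ {v} {y} y∈ with ⁅ v ⁆ ∪ ⁅ y ⁆ ∈ˡ? F | trans (sym (lookup∘tabulate (λ y → does (⁅ v ⁆ ∪ ⁅ y ⁆ ∈ˡ? F)) y)) ([]=⇒lookup y∈)
  ... | yes e | _ = e

  N-sym : ∀ {v y} → y ∈ N v → v ∈ N y
  N-sym {v} {y} = ∈N⁺ ∘ subst (_∈ˡ F) (∪-comm ⁅ v ⁆ ⁅ y ⁆) ∘ ∈N⁻

  ⋃-closed : ∀ {ps} → ps ⊆ˡ F → ⋃ ps ∈ˡ F
  ⋃-closed {[]} _ = ⊥∈F
  ⋃-closed {p ∷ ps} ps⊆F = ∪-closed (ps⊆F (here refl)) (⋃-closed (ps⊆F ∘ there))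

  -- The union of all members inside `S` is all of `S`, since each `v` is covered by an edge or loop
  -- inside `S`.
  member⁺ : ∀ {S} → (∀ {v} → v ∈ S → ∃ λ y → y ∈ S × y ∈ N v) → S ∈ˡ F
  member⁺ {S} nbr = subst (_∈ˡ F) (⊆-antisym below above) (⋃-closed (proj₁ ∘ ∈-filter⁻ (_⊆? S)))
    where
    below : ⋃ (filter (_⊆? S) F) ⊆ S
    below v∈ with p , p∈ , v∈p ← ∈⋃⁻ _ v∈ = proj₂ (∈-filter⁻ (_⊆? S) {xs = F} p∈) v∈p
    above : S ⊆ ⋃ (filter (_⊆? S) F)
    above {v} v∈S with y , y∈S , y∈Nv ← nbr v∈S =
      ∈⋃⁺ (∈-filter⁺ (_⊆? S) (∈N⁻ y∈Nv) (∪-least (x∈p⇒⁅x⁆⊆p v∈S) (x∈p⇒⁅x⁆⊆p y∈S)))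
          (p⊆p∪q ⁅ y ⁆ (x∈⁅x⁆ v))

  -- Strong induction on the size of `S`. If `S` is the union of its proper submembers, a smaller
  -- member contains `v` and supplies the neighbour; otherwise `S` is a generator, hence a pair
  -- `{v, y}` or a singleton.
  member⁻ : ∀ {S v} → S ∈ˡ F → v ∈ S → ∃ λ y → y ∈ S × y ∈ N v
  member⁻ = go (<-wellFounded _)
    where
    go : ∀ {S v} → Acc _<_ ∣ S ∣ → S ∈ˡ F → v ∈ S → ∃ λ y → y ∈ S × y ∈ N v
    go {S} {v} (acc rs) S∈F v∈S with S ≟ˢ ⋃ (properSubmembers F S)
    ... | yes S≡⋃ with p , p∈ , v∈p ← ∈⋃⁻ _ (subst (v ∈_) S≡⋃ v∈S)
                  with p∈F , p⊂S ← ∈-filter⁻ (_⊂? S) p∈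
                  with y , y∈p , y∈N ← go (rs (p⊂q⇒∣p∣<∣q∣ p⊂S)) p∈F v∈p = y , proj₁ p⊂S y∈p , y∈N
    ... | no S≢⋃ with y , y∈S , S≡ ← ∣p∣≤2⇒pair v∈S
                      ([ (λ e → ≤-trans (≤-reflexive e) (s≤s z≤n)) , ≤-reflexive ]′ (graph (S∈F , (v , v∈S) , S≢⋃))) =
      y , y∈S , ∈N⁺ (subst (_∈ˡ F) S≡ S∈F)

  -- No proper submember of `V` contains `w`, so their union misses `w`.
  minimal⇒generator : ∀ {V w} → V ∈ˡ F → w ∈ V → (∀ {W} → W ∈ˡ F → w ∈ W → W ⊆ V → V ⊆ W) → IsGenerator F V
  minimal⇒generator {V} {w} V∈F w∈V minimal = V∈F , (w , w∈V) , λ V≡⋃ →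
    let W , W∈ , w∈W = ∈⋃⁻ _ (subst (w ∈_) V≡⋃ w∈V)
        W∈F , W⊆V , x , x∈V , x∉W = ∈-filter⁻ (_⊂? V) {xs = F} W∈
    in x∉W (minimal W∈F w∈W W⊆V x∈V)

  ⁅v⁆-generator : ∀ {v} → v ∈ N v → IsGenerator F ⁅ v ⁆
  ⁅v⁆-generator {v} v∈Nv = minimal⇒generator (subst (_∈ˡ F) (∪-idem ⁅ v ⁆) (∈N⁻ v∈Nv)) (x∈⁅x⁆ v)
    (λ _ v∈W _ → x∈p⇒⁅x⁆⊆p v∈W)

  -- A member through the loopless `b` contains another element adjacent to `b`; inside `{b, z}`
  -- that can only be `z`.
  edge-generator : ∀ {b z} → b ∉ N b → z ∈ N b → IsGenerator F (⁅ b ⁆ ∪ ⁅ z ⁆)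
  edge-generator {b} {z} b∉Nb z∈Nb = minimal⇒generator (∈N⁻ z∈Nb) (p⊆p∪q ⁅ z ⁆ (x∈⁅x⁆ b)) minimal
    where
    minimal : ∀ {W} → W ∈ˡ F → b ∈ W → W ⊆ ⁅ b ⁆ ∪ ⁅ z ⁆ → ⁅ b ⁆ ∪ ⁅ z ⁆ ⊆ W
    minimal W∈F b∈W W⊆ with y , y∈W , y∈Nb ← member⁻ W∈F b∈W with x∈p∪q⁻ _ _ (W⊆ y∈W)
    ... | inj₁ y∈⁅b⁆ with refl ← x∈⁅y⁆⇒x≡y _ y∈⁅b⁆ = contradiction y∈Nb b∉Nb
    ... | inj₂ y∈⁅z⁆ with refl ← x∈⁅y⁆⇒x≡y _ y∈⁅z⁆ = ∪-least (x∈p⇒⁅x⁆⊆p b∈W) (x∈p⇒⁅x⁆⊆p y∈W)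

  -- Neighbourhood traces and bad sets

  Trace : Fin n → Subset n → Subset n → Set
  Trace v X S = v ∈ S × N v ∩ S ≡ X

  Trace? : ∀ v X → Decidable (Trace v X)
  Trace? v X S = v ∈? S ×-dec N v ∩ S ≟ˢ X

  traces : Fin n → Subset n → ℕ
  traces v X = count (Trace? v X) F

  trace∋ : ∀ {v X S y} → Trace v X S → y ∈ N v → y ∈ S → y ∈ X
  trace∋ {y = y} (_ , e) y∈Nv y∈S = subst (y ∈_) e (x∈p∩q⁺ (y∈Nv , y∈S))

  trace⊆ : ∀ {v X S} → Trace v X S → X ⊆ S
  trace⊆ {v} {S = S} (_ , e) {y} y∈X = p∩q⊆q (N v) S (subst (y ∈_) (sym e) y∈X)

  nbrs : Fin n → List (Fin n)
  nbrs v = filter (_∈? N v) (allFin n)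

  nbrs-unique : ∀ {v} → Unique (nbrs v)
  nbrs-unique {v} = Unique.filter⁺ (_∈? N v) (Unique.allFin⁺ n)

  ∈-nbrs⁺ : ∀ {v y} → y ∈ N v → y ∈ˡ nbrs v
  ∈-nbrs⁺ {v} {y} = ∈-filter⁺ (_∈? N v) (∈-allFin y)

  ∈-nbrs⁻ : ∀ {v y} → y ∈ˡ nbrs v → y ∈ N v
  ∈-nbrs⁻ {v} = proj₂ ∘ ∈-filter⁻ (_∈? N v) {xs = allFin n}

  -- A vertex whose only neighbour in `S` is `b` is itself adjacent to `b`, so ranging over `nbrs b`
  -- misses no witness and gives a union bound with deg(b) terms.
  Bad : Fin n → Subset n → Set
  Bad b S = Any (λ c → Trace c ⁅ b ⁆ S) (nbrs b)

  Bad? : ∀ b → Decidable (Bad b)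
  Bad? b S = Any.any? (λ c → Trace? c ⁅ b ⁆ S) (nbrs b)

  Good : Fin n → Subset n → Set
  Good b S = b ∈ S × ¬ Bad b S

  Good? : ∀ b → Decidable (Good b)
  Good? b S = b ∈? S ×-dec ¬? (Bad? b S)

  good⇒delete : ∀ {b S} → S ∈ˡ F → Good b S → S - b ∈ˡ F
  good⇒delete {b} {S} S∈F (b∈S , ¬bad) = member⁺ nbr
    where
    nbr : ∀ {v} → v ∈ S - b → ∃ λ y → y ∈ S - b × y ∈ N v
    nbr {v} v∈ with nonempty? ((N v ∩ S) - b)
    ... | yes (y , y∈) with y∈Nv , y∈S ← x∈p∩q⁻ (N v) S (p─q⊆p _ ⁅ b ⁆ y∈) =
      y , x∈p∧x∉q⇒x∈p─q y∈S (x∈p─q⇒x∉q (N v ∩ S) ⁅ b ⁆ y∈) , y∈Nv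
    -- Here `v` has no neighbour in `S` besides `b`, yet it has one, so `v` witnesses that `S` is
    -- bad.
    ... | no ¬ne = contradiction (Any.map (λ { refl → v∈S , trace }) (∈-nbrs⁺ (N-sym b∈Nv))) ¬bad
      where
      v∈S = p─q⊆p S ⁅ b ⁆ v∈
      only : ∀ {y} → y ∈ N v ∩ S → y ≡ b
      only {y} y∈ with y ≟ᶠ b
      ... | yes y≡b = y≡b
      ... | no y≢b  = contradiction (y , x∈p∧x≢y⇒x∈p-y y∈ y≢b) ¬ne
      b∈Nv : b ∈ N v
      b∈Nv with y , y∈S , y∈Nv ← member⁻ S∈F v∈S = subst (_∈ N v) (only (x∈p∩q⁺ (y∈Nv , y∈S))) y∈Nv
      trace : N v ∩ S ≡ ⁅ b ⁆
      trace = ⊆-antisym (λ y∈ → subst (_∈ ⁅ b ⁆) (sym (only y∈)) (x∈⁅x⁆ b)) (x∈p⇒⁅x⁆⊆p (x∈p∩q⁺ (b∈Nv , b∈S)))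

  -- A sufficient condition for an edge to be rare

  Rare : Subset n → Set
  Rare U = 2 * countSupersets F U ≤ length F

  pair⁻ : ∀ {b z : Fin n} {S} → ⁅ b ⁆ ∪ ⁅ z ⁆ ⊆ S → b ∈ S × z ∈ S
  pair⁻ {b} {z} U⊆S = U⊆S (p⊆p∪q ⁅ z ⁆ (x∈⁅x⁆ b)) , U⊆S (q⊆p∪q ⁅ b ⁆ _ (x∈⁅x⁆ z))

  Avoids : Fin n → Fin n → Subset n → Set
  Avoids b z S = b ∈ S × z ∉ S

  Avoids? : ∀ b z → Decidable (Avoids b z)
  Avoids? b z S = b ∈? S ×-dec ¬? (z ∈? S)

  Meets : Fin n → Subset n → Set
  Meets b S = b ∉ S × Nonempty (N b ∩ S)

  Meets? : ∀ b → Decidable (Meets b)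
  Meets? b S = ¬? (b ∈? S) ×-dec nonempty? (N b ∩ S)

  Remote : Fin n → Subset n → Set
  Remote b S = b ∉ S × ¬ Nonempty (N b ∩ S)

  Remote? : ∀ b → Decidable (Remote b)
  Remote? b S = ¬? (b ∈? S) ×-dec ¬? (nonempty? (N b ∩ S))

  -- Deleting `b` is undone by adding it back. The neighbour of `b` in `S` differs from `b` and
  -- survives, so the image still meets `N b`.
  count-good≤meets : ∀ {b} → b ∉ N b → count (Good? b) F ≤ count (Meets? b) F
  count-good≤meets {b} b∉Nb = count-image _≟ˢ_ (Good? b) (Meets? b) unique (_∪ ⁅ b ⁆) preimage
    where
    preimage : ∀ {S} → S ∈ˡ F → Good b S → ∃ λ T → T ∈ˡ F × Meets b T × T ∪ ⁅ b ⁆ ≡ S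
    preimage {S} S∈F good@(b∈S , _) with y , y∈S , y∈Nb ← member⁻ S∈F b∈S =
      S - b , good⇒delete S∈F good ,
      ((λ b∈ → x∈p─q⇒x∉q S ⁅ b ⁆ b∈ (x∈⁅x⁆ b)) ,
       y , x∈p∩q⁺ (y∈Nb , x∈p∧x≢y⇒x∈p-y y∈S λ { refl → b∉Nb y∈Nb })) ,
      p⊆q⇒q─p∪p≡q (x∈p⇒⁅x⁆⊆p b∈S)

  -- With the abbreviations below, m + o ≤ bad + good ≤ 2o + e + good ≤ 2o + ∌b. Cancelling o gives
  -- m ≤ o + ∌b, and adding m once more gives 2m ≤ (m + o) + ∌b, which is at most the size of `F`.
  rare-edge : ∀ {b z} → b ∉ N b →
              count (Bad? b) F ≤ 2 * count (Avoids? b z) F + count (Remote? b) F → Rare (⁅ b ⁆ ∪ ⁅ z ⁆)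
  rare-edge {b} {z} b∉Nb bad≤ = begin
    2 * m        ≡⟨ cong (m +_) (+-identityʳ m) ⟩
    m + m        ≤⟨ +-monoʳ-≤ m m≤o+∌b ⟩
    m + (o + ∌b) ≡⟨ +-assoc m o ∌b ⟨
    m + o + ∌b   ≤⟨ +-monoˡ-≤ ∌b m+o≤∋b ⟩
    ∋b + ∌b      ≤⟨ count-disjoint U? (b ∈?_) (λ S → ¬? (b ∈? S)) F _ _ (λ b∈S b∉S → b∉S b∈S) ⟩
    count U? F   ≤⟨ length-filter U? F ⟩
    length F     ∎
    where
    open ≤-Reasoning
    m = countSupersets F (⁅ b ⁆ ∪ ⁅ z ⁆)
    o = count (Avoids? b z) F
    e = count (Remote? b) F
    ∋b = count (b ∈?_) F
    ∌b = count (λ S → ¬? (b ∈? S)) F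
    bad = count (Bad? b) F
    good = count (Good? b) F

    m+o≤∋b : m + o ≤ ∋b
    m+o≤∋b = count-disjoint (b ∈?_) ((⁅ b ⁆ ∪ ⁅ z ⁆) ⊆?_) (Avoids? b z) F
      (proj₁ ∘ pair⁻) proj₁ (λ U⊆S avoids → proj₂ avoids (proj₂ (pair⁻ U⊆S)))

    ∋b≤bad+good : ∋b ≤ bad + good
    ∋b≤bad+good = count-cover (b ∈?_) (Bad? b) (Good? b) F λ {S} → split S
      where
      split : ∀ S → b ∈ S → Bad b S ⊎ Good b S
      split S b∈S with Bad? b S
      ... | yes bad = inj₁ bad
      ... | no ¬bad = inj₂ (b∈S , ¬bad)

    e+good≤∌b : e + good ≤ ∌b
    e+good≤∌b = ≤-trans (+-monoʳ-≤ e (count-good≤meets b∉Nb))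
      (count-disjoint (λ S → ¬? (b ∈? S)) (Remote? b) (Meets? b) F proj₁ proj₁ (λ remote meets → proj₂ remote (proj₂ meets)))

    m≤o+∌b : m ≤ o + ∌b
    m≤o+∌b = +-cancelʳ-≤ o m (o + ∌b) (begin
      m + o                ≤⟨ ≤-trans m+o≤∋b ∋b≤bad+good ⟩
      bad + good           ≤⟨ +-monoˡ-≤ good bad≤ ⟩
      2 * o + e + good     ≡⟨ +-assoc (2 * o) e good ⟩
      2 * o + (e + good)   ≤⟨ +-monoʳ-≤ (2 * o) e+good≤∌b ⟩
      2 * o + ∌b           ≡⟨ cong (_+ ∌b) (cong (o +_) (+-identityʳ o)) ⟩
      o + o + ∌b           ≡⟨ +-assoc o o ∌b ⟩
      o + (o + ∌b)         ≡⟨ +-comm o (o + ∌b) ⟩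
      o + ∌b + o           ∎)

  -- The two cases for the degree of `b`

  rare-leaf : ∀ {b x} → b ∉ N b → x ∈ N b → (∀ {y} → y ∈ N b → y ≡ x) → Rare (⁅ b ⁆ ∪ ⁅ x ⁆)
  rare-leaf {b} {x} b∉Nb x∈Nb leaf = rare-edge b∉Nb
    (≤-trans (count-image _≟ˢ_ (Bad? b) (Remote? b) unique (_∪ U) preimage) (m≤n+m _ _))
    where
    U = ⁅ b ⁆ ∪ ⁅ x ⁆
    preimage : ∀ {S} → S ∈ˡ F → Bad b S → ∃ λ T → T ∈ˡ F × Remote b T × T ∪ U ≡ S
    -- The witness `c` is a neighbour of `b`, hence equals `x`; so `b` is the only neighbour of `x`
    -- in `S`.
    preimage {S} S∈F bad with c , c∈ , trace ← find bad with refl ← leaf (∈-nbrs⁻ c∈) =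
      S ─ U , member⁺ nbr , (b∉ , remote) , p⊆q⇒q─p∪p≡q (∪-least (trace⊆ trace) (x∈p⇒⁅x⁆⊆p (proj₁ trace)))
      where
      avoids : ∀ {y} → y ∈ S ─ U → y ∉ U
      avoids = x∈p─q⇒x∉q S U
      b∉ : b ∉ S ─ U
      b∉ b∈ = avoids b∈ (p⊆p∪q ⁅ x ⁆ (x∈⁅x⁆ b))
      x∉ : x ∉ S ─ U
      x∉ x∈ = avoids x∈ (q⊆p∪q ⁅ b ⁆ _ (x∈⁅x⁆ x))
      remote : ¬ Nonempty (N b ∩ (S ─ U))
      remote (y , y∈) with y∈Nb , y∈T ← x∈p∩q⁻ (N b) _ y∈ with refl ← leaf y∈Nb = x∉ y∈T
      nbr : ∀ {v} → v ∈ S ─ U → ∃ λ y → y ∈ S ─ U × y ∈ N v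
      nbr {v} v∈ with y , y∈S , y∈Nv ← member⁻ S∈F (p─q⊆p S U v∈) =
        y , x∈p∧x∉q⇒x∈p─q y∈S ([ y∉⁅b⁆ , y∉⁅x⁆ ]′ ∘ x∈p∪q⁻ _ _) , y∈Nv
        where
        -- If `y` were `b`, then `v` would be its only neighbour `x`; if `y` were `x`, then `v`
        -- would be `b`. Both have been removed.
        y∉⁅b⁆ : y ∉ ⁅ b ⁆
        y∉⁅b⁆ y∈ with refl ← x∈⁅y⁆⇒x≡y _ y∈ with refl ← leaf (N-sym y∈Nv) = x∉ v∈
        y∉⁅x⁆ : y ∉ ⁅ x ⁆
        y∉⁅x⁆ y∈ with refl ← x∈⁅y⁆⇒x≡y _ y∈
          with refl ← x∈⁅y⁆⇒x≡y _ (trace∋ trace (N-sym y∈Nv) (p─q⊆p S U v∈)) = b∉ v∈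

  -- Adding `w` keeps `S` in `F`, as `w` is adjacent to `b`. For `w ≢ x` the trace shows `w ∉ S`, so
  -- removing `w` recovers `S`; for `w ≡ x` the two traces coincide.
  traces-mono : ∀ {b x w} → w ∈ N b → traces b ⁅ x ⁆ ≤ traces b (⁅ x ⁆ ∪ ⁅ w ⁆)
  traces-mono {b} {x} {w} w∈Nb with w ≟ᶠ x
  ... | yes refl = ≤-reflexive (cong (traces b) (sym (∪-idem ⁅ x ⁆)))
  ... | no w≢x = count-image _≟ˢ_ (Trace? b ⁅ x ⁆) (Trace? b (⁅ x ⁆ ∪ ⁅ w ⁆)) unique (_- w) preimage
    where
    preimage : ∀ {S} → S ∈ˡ F → Trace b ⁅ x ⁆ S → ∃ λ T → T ∈ˡ F × Trace b (⁅ x ⁆ ∪ ⁅ w ⁆) T × T - w ≡ S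
    preimage {S} S∈F trace@(b∈S , NS≡x) =
      S ∪ ⁅ w ⁆ , member⁺ (nbr ∘ x∈p∪q⁻ S _) , (p⊆p∪q ⁅ w ⁆ b∈S , NT≡xw) ,
      x∉p⇒p∪⁅x⁆-x≡p (λ w∈S → w≢x (x∈⁅y⁆⇒x≡y _ (trace∋ trace w∈Nb w∈S)))
      where
      nbr : ∀ {v} → v ∈ S ⊎ v ∈ ⁅ w ⁆ → ∃ λ y → y ∈ S ∪ ⁅ w ⁆ × y ∈ N v
      nbr (inj₁ v∈S) with y , y∈S , y∈Nv ← member⁻ S∈F v∈S = y , p⊆p∪q ⁅ w ⁆ y∈S , y∈Nv
      nbr (inj₂ v∈⁅w⁆) with refl ← x∈⁅y⁆⇒x≡y _ v∈⁅w⁆ = b , p⊆p∪q ⁅ w ⁆ b∈S , N-sym w∈Nb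
      NT≡xw : N b ∩ (S ∪ ⁅ w ⁆) ≡ ⁅ x ⁆ ∪ ⁅ w ⁆
      NT≡xw = trans (∩-distribˡ-∪ (N b) S ⁅ w ⁆) (cong₂ _∪_ NS≡x
        (⊆-antisym (p∩q⊆q (N b) ⁅ w ⁆) (x∈p⇒⁅x⁆⊆p (x∈p∩q⁺ (w∈Nb , x∈⁅x⁆ w)))))

  module _ {b x} (b∉Nb : b ∉ N b) (x∈Nb : x ∈ N b)
           (maximal : ∀ {c d} → c ∉ N c → d ∈ N c → traces c ⁅ d ⁆ ≤ traces b ⁅ x ⁆) where

    private P = traces b ⁅ x ⁆

    count-bad≤ : count (Bad? b) F ≤ length (nbrs b) * P
    count-bad≤ = count-Any (λ c → Trace? c ⁅ b ⁆) P F (nbrs b) (bound ∘ ∈-nbrs⁻)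
      where
      bound : ∀ {c} → c ∈ N b → traces c ⁅ b ⁆ ≤ P
      bound {c} c∈Nb with c ∈? N c
      ... | no c∉Nc = maximal c∉Nc (N-sym c∈Nb)
      -- Maximality covers loopless `c` only. A looped `c` lies in its own trace `⁅ b ⁆`, forcing
      -- `c ≡ b`, so it contributes nothing.
      ... | yes c∈Nc = ≤-trans (≤-reflexive (count-none (Trace? c ⁅ b ⁆) F empty)) z≤n
        where
        empty : ∀ S → ¬ Trace c ⁅ b ⁆ S
        empty S trace@(c∈S , _) with refl ← x∈⁅y⁆⇒x≡y _ (trace∋ trace c∈Nc c∈S) = b∉Nb c∈Nb

    rare-branch : ∀ {z} → z ∈ N b → z ≢ x → Rare (⁅ b ⁆ ∪ ⁅ z ⁆)
    rare-branch {z} z∈Nb z≢x = rare-edge b∉Nb (begin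
      count (Bad? b) F                                     ≤⟨ count-bad≤ ⟩
      length (nbrs b) * P                                  ≤⟨ *-monoˡ-≤ P deg≤ ⟩
      2 * length ws * P                                    ≡⟨ *-assoc 2 (length ws) P ⟩
      2 * (length ws * P)                                  ≤⟨ *-monoʳ-≤ 2 packed ⟩
      2 * count (Avoids? b z) F                            ≤⟨ m≤m+n _ _ ⟩
      2 * count (Avoids? b z) F + count (Remote? b) F      ∎)
      where
      open ≤-Reasoning
      -- The deg(b) - 1 neighbours other than `z`. Among them is `x`, so there is at least one,
      -- whence deg(b) is at most twice their number.
      ws = filter (λ w → ¬? (w ≟ᶠ z)) (nbrs b)

      nbrs⊆z∷ws : nbrs b ⊆ˡ z ∷ ws
      nbrs⊆z∷ws {w} w∈ with w ≟ᶠ z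
      ... | yes w≡z = here w≡z
      ... | no w≢z  = there (∈-filter⁺ _ w∈ w≢z)

      deg≤ : length (nbrs b) ≤ 2 * length ws
      deg≤ = begin
        length (nbrs b)         ≤⟨ length-mono-⊆ _≟ᶠ_ nbrs-unique nbrs⊆z∷ws ⟩
        1 + length ws           ≤⟨ +-monoˡ-≤ _ (∈-length (∈-filter⁺ _ (∈-nbrs⁺ x∈Nb) (z≢x ∘ sym))) ⟩
        length ws + length ws   ≡⟨ cong (length ws +_) (+-identityʳ _) ⟨
        2 * length ws           ∎

      Q? : ∀ w → Decidable (Trace b (⁅ x ⁆ ∪ ⁅ w ⁆))
      Q? w = Trace? b (⁅ x ⁆ ∪ ⁅ w ⁆)

      -- From `{x, c} = {x, d}`, either `c` and `d` agree directly or both equal `x`.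
      exclusive : ∀ {c d S} → Trace b (⁅ x ⁆ ∪ ⁅ c ⁆) S → Trace b (⁅ x ⁆ ∪ ⁅ d ⁆) S → c ≡ d
      exclusive {c} {d} (_ , ec) (_ , ed)
        with x∈p∪q⁻ ⁅ x ⁆ _ (subst (c ∈_) (trans (sym ec) ed) (q⊆p∪q ⁅ x ⁆ _ (x∈⁅x⁆ c)))
           | x∈p∪q⁻ ⁅ x ⁆ _ (subst (d ∈_) (trans (sym ed) ec) (q⊆p∪q ⁅ x ⁆ _ (x∈⁅x⁆ d)))
      ... | inj₂ c∈ | _       = x∈⁅y⁆⇒x≡y _ c∈
      ... | inj₁ _  | inj₂ d∈ = sym (x∈⁅y⁆⇒x≡y _ d∈)
      ... | inj₁ c∈ | inj₁ d∈ = trans (x∈⁅y⁆⇒x≡y _ c∈) (sym (x∈⁅y⁆⇒x≡y _ d∈))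

      packed : length ws * P ≤ count (Avoids? b z) F
      packed = ≤-trans
        (count-pack Q? P F (Unique.filter⁺ _ nbrs-unique) exclusive
          (λ w∈ → traces-mono (∈-nbrs⁻ (proj₁ (∈-filter⁻ (λ w → ¬? (w ≟ᶠ z)) {xs = nbrs b} w∈)))))
        -- With the identity as `g` this is monotonicity of counting: a trace `{x, w}` with `x` and
        -- `w` both different from `z` rules out `z ∈ S`.
        (count-image _≟ˢ_ (λ S → Any.any? (λ w → Q? w S) ws) (Avoids? b z) unique id
          (λ S∈F any → _ , S∈F , avoids any , refl))
        where
        avoids : ∀ {S} → Any (λ w → Trace b (⁅ x ⁆ ∪ ⁅ w ⁆) S) ws → Avoids b z S
        avoids any with w , w∈ , trace ← find any = proj₁ trace , λ z∈S →
          [ (λ z∈⁅x⁆ → z≢x (x∈⁅y⁆⇒x≡y _ z∈⁅x⁆))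
          , (λ z∈⁅w⁆ → proj₂ (∈-filter⁻ (λ w → ¬? (w ≟ᶠ z)) {xs = nbrs b} w∈) (sym (x∈⁅y⁆⇒x≡y _ z∈⁅w⁆)))
          ]′ (x∈p∪q⁻ _ _ (trace∋ trace z∈Nb z∈S))

    rare-generator : ∃ λ U → IsGenerator F U × Rare U
    rare-generator with nonempty? (N b - x)
    ... | yes (z , z∈) =
      let z∈Nb = p─q⊆p (N b) ⁅ x ⁆ z∈
      in _ , edge-generator b∉Nb z∈Nb ,
         rare-branch z∈Nb (λ { refl → x∈p─q⇒x∉q (N b) ⁅ x ⁆ z∈ (x∈⁅x⁆ x) })
    ... | no ¬ne = _ , edge-generator b∉Nb x∈Nb , rare-leaf b∉Nb x∈Nb leaf
      where
      leaf : ∀ {y} → y ∈ N b → y ≡ x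
      leaf {y} y∈Nb with y ≟ᶠ x
      ... | yes y≡x = y≡x
      ... | no y≢x  = contradiction (y , x∈p∧x≢y⇒x∈p-y y∈Nb y≢x) ¬ne

  -- When every element of a member is looped, each remaining element is its own neighbour after `v`
  -- is deleted, so deletion stays in `F`.
  rare-singleton : (∀ {S v} → S ∈ˡ F → v ∈ S → v ∈ N v) → ∀ {v} → Rare ⁅ v ⁆
  rare-singleton loops {v} = begin
    2 * m             ≡⟨ cong (m +_) (+-identityʳ m) ⟩
    m + m             ≤⟨ +-monoʳ-≤ m (count-image _≟ˢ_ (⁅ v ⁆ ⊆?_) (λ S → ¬? (v ∈? S)) unique (_∪ ⁅ v ⁆) preimage) ⟩
    m + count (λ S → ¬? (v ∈? S)) F
      ≤⟨ count-disjoint U? (⁅ v ⁆ ⊆?_) (λ S → ¬? (v ∈? S)) F _ _ (λ v⊆S v∉S → v∉S (v⊆S (x∈⁅x⁆ v))) ⟩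
    count U? F        ≤⟨ length-filter U? F ⟩
    length F          ∎
    where
    open ≤-Reasoning
    m = countSupersets F ⁅ v ⁆
    preimage : ∀ {S} → S ∈ˡ F → ⁅ v ⁆ ⊆ S → ∃ λ T → T ∈ˡ F × v ∉ T × T ∪ ⁅ v ⁆ ≡ S
    preimage {S} S∈F v⊆S =
      S - v , member⁺ (λ {y} y∈ → y , y∈ , loops S∈F (p─q⊆p S ⁅ v ⁆ y∈)) ,
      (λ v∈ → x∈p─q⇒x∉q S ⁅ v ⁆ v∈ (x∈⁅x⁆ v)) , p⊆q⇒q─p∪p≡q v⊆S

  -- Choice of a maximal pair and conclusion

  Arc : Fin n × Fin n → Set
  Arc (b , x) = b ∉ N b × x ∈ N b

  Arc? : Decidable Arc
  Arc? (b , x) = ¬? (b ∈? N b) ×-dec x ∈? N b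

  arcs : List (Fin n × Fin n)
  arcs = filter Arc? (cartesianProduct (allFin n) (allFin n))

  ∈-arcs⁺ : ∀ {b x} → b ∉ N b → x ∈ N b → (b , x) ∈ˡ arcs
  ∈-arcs⁺ b∉ x∈ = ∈-filter⁺ Arc? (∈-cartesianProduct⁺ (∈-allFin _) (∈-allFin _)) (b∉ , x∈)

  maximal-arc : ∀ ps → (∀ {p} → p ∈ˡ ps → Arc p) → ps ≢ [] →
                ∃ λ p → Arc p × (∀ {q} → q ∈ˡ ps → traces (proj₁ q) ⁅ proj₂ q ⁆ ≤ traces (proj₁ p) ⁅ proj₂ p ⁆)
  maximal-arc [] _ []≢[] = contradiction refl []≢[]
  maximal-arc (p ∷ ps) arc _ =
    -- The head `p` is the default value of `argmax`, so the maximiser is always an entry of the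
    -- list.
    argmax f p ps , argmax-all f (arc (here refl)) (All.tabulate (arc ∘ there)) ,
    λ { (here refl) → f[⊥]≤f[argmax] {f = f} p ps ; (there q∈) → All.lookup (f[xs]≤f[argmax] {f = f} p ps) q∈ }
    where
    f : Fin n × Fin n → ℕ
    f (b , x) = traces b ⁅ x ⁆

  nonempty-member : 2 ≤ length F → ∃ λ S → S ∈ˡ F × Nonempty S
  nonempty-member 2≤∣F∣ with Any.any? nonempty? F
  ... | yes any = find any
  -- If every member were empty, the repetition-free `F` would fit inside the one-entry list of `⊥`.
  ... | no ¬any = contradiction 2≤∣F∣ (<⇒≱ (s≤s (length-mono-⊆ _≟ˢ_ {ys = ⊥ ∷ []} unique
    λ {S} S∈F → here (Empty-unique λ ne → ¬any (lose S∈F ne)))))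

  rare : 2 ≤ length F → ∃ λ U → IsGenerator F U × Rare U
  rare 2≤∣F∣ with arcs in eq
  ... | _ ∷ _ with (b , x) , (b∉ , x∈) , max
    ← maximal-arc arcs (proj₂ ∘ ∈-filter⁻ Arc? {xs = cartesianProduct (allFin n) (allFin n)})
                  (λ e → case trans (sym e) eq of λ ()) =
    rare-generator b∉ x∈ (λ c∉ d∈ → max (∈-arcs⁺ c∉ d∈))
  ... | [] with S , S∈F , v , v∈S ← nonempty-member 2≤∣F∣ = ⁅ v ⁆ , ⁅v⁆-generator (loops S∈F v∈S) , rare-singleton loops
    where
    loops : ∀ {S v} → S ∈ˡ F → v ∈ S → v ∈ N v
    loops {v = v} S∈F v∈S with v ∈? N v
    ... | yes v∈Nv = v∈Nv
    -- A loopless `v` in a member has a neighbour `y`, and `(v , y)` would belong to the empty list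
    -- of arcs.
    ... | no v∉Nv with y , _ , y∈Nv ← member⁻ S∈F v∈S with () ← subst ((v , y) ∈ˡ_) eq (∈-arcs⁺ v∉Nv y∈Nv)

theorem3p1 : (n : ℕ) (F : Family n) → IsFamily F → UnionClosed F → ⊥ ∈ˡ F → 2 ≤ length F → GraphGenerated F → Σ (Subset n) (λ U → IsGenerator F U × 2 * countSupersets F U ≤ length F)
theorem3p1 n F unique ∪-closed ⊥∈F 2≤∣F∣ graph = GraphFamily.rare F unique ∪-closed ⊥∈F graph 2≤∣F∣
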